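{- Let $D=(N,A)$, $\mathcal{K}$, $\{D^k\}_{k\in\mathcal{K}}$ be an instance of SND-RR with time horizon $T$, let $\mathcal{A}$ be a valid arc partition and $G=G(D,\mathcal{A})$ the auxiliary flat network. Then the integer programs SND-RR$(D_T)$ and SND-RR$(G_T)$ have the same number of variables and the same number of constraints, and they are equivalent: there is a bijection between their feasible solutions preserving the objective value.
   Context: An instance of SND-RR consists of: a directed graph $D=(N,A)$; for each arc $vw\in A$ a transit time $\tau_{vw}\in\mathbb{Z}_{>0}$, fixed cost $f_{vw}>0$, capacity $u_{vw}\in\mathbb{Z}_{>0}$, and per-unit cost $c^k_{vw}>0$ for each commodity $k$; a set $\mathcal{K}$ of commodities, each with origin $o_k$, destination $d_k$, demand $q_k$, release time $r_k$, deadline $l_k$ (integers, earliest release $0$); and subgraphs $D^k=(N^k,A^k)\subseteq D$. Standing assumption: $\delta^+_{D^k}(d_k)=\emptyset$ and $\delta^+_{D^k}(v)\ne\emptyset$ for $v\in N^k\setminus\{d_k\}$. $T=\max_kl_k$, $[T]=\{0,\dots,T\}$. For any flat graph $H$ with transit times, its time-expanded network $H_T$ has timed nodes $(v,t)$, $t\in[T]$, movement arcs $((v,t),(w,t+\tau_{vw}))$ for arcs $vw$ of $H$ with $t+\tau_{vw}\le T$, and holdover arcs $((v,t),(v,t+1))$. $D_T=(N_T,A_T\cup H_T)$, $D^k_T=(N^k_T,A^k_T\cup H^k_T)$. For a timed arc $a=((v,t),(w,t'))$, $u_a=u_{vw}$, $f_a=f_{vw}$, $c^k_a=c^k_{vw}$;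 $x^k(S)=\sum_{a\in S}x^k_a$; $\delta^\pm$ denote outgoing/incoming timed arcs. SND-RR$(D_T)$: minimize $\sum_{a\in A_T}f_ay_a+\sum_{a\in A_T}\sum_kc^k_aq_kx^k_a$ s.t. for all $k$, $(v,t)\in N^k_T$: $x^k(\delta^+_{D^k_T}(v,t))-x^k(\delta^-_{D^k_T}(v,t))$ is $1$ at $(o_k,r_k)$, $-1$ at $(d_k,l_k)$, $0$ otherwise; $\sum_kq_kx^k_a\le u_ay_a$ for $a\in A_T$; $x^k_a\in\{0,1\}$ for $a\in A^k_T\cup H^k_T$; $y_a\in\mathbb{Z}_{\ge0}$ for $a\in A_T$. Valid partition: $\mathcal{A}=\{\mathcal{A}_v\}_{v\in N}$ with each $\mathcal{A}_v$ a partition of $\delta^+_D(v)$ such that for each $k$, $\delta^+_{D^k}(v)\subseteq A_i$ for some $A_i\in\mathcal{A}_v$. Auxiliary network $G=(V,E)$: $\mathcal{V}(v)=\{v^0,\dots,v^{|\mathcal{A}_v|}\}$ (copy $v^i$ per part $A_i$, terminal copy $v^0$), $V=\bigcup_v\mathcal{V}(v)$, $E=\{v^iw^j: vw\in A_i\in\mathcal{A}_v, w^j\in\mathcal{V}(w)\}$; each $v^iw^j$ gets the transit time and costs of $vw$. With $\mathcal{K}(A_i)=\{k:\emptyset\ne\delta^+_{D^k}(v)\subseteq A_i\}$ for $A_i\in\mathcal{A}_v$: $G^k=(V^k,E^k)$, $V^k=\{v^i:v\in N^k,A_i\in\mathcal{A}_v,k\in\mathcal{K}(A_i)\}\cup\{d^0_k\}$,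 $E^k=\{v^iw^j:vw\in A^k,v^i,w^j\in V^k\}$; $o'_k$ denotes the unique copy of $o_k$ in $V^k$. $G_T=(V_T,E_T\cup F_T)$ and $G^k_T=(V^k_T,E^k_T\cup F^k_T)$ are the time-expanded networks. For $a=((v,t),(w,t'))\in A_T$, $\mathcal{E}_T(a)=\{((v^i,t),(w^j,t')): vw\in A_i\in\mathcal{A}_v, w^j\in\mathcal{V}(w)\}$. SND-RR$(G_T)$: minimize $\sum_{a\in A_T}f_ay_a+\sum_k\sum_{e\in E_T}c^k_eq_kx^k_e$ s.t. for all $k$, $(v,t)\in V^k_T$: $x^k(\delta^+_{G^k_T}(v,t))-x^k(\delta^-_{G^k_T}(v,t))$ is $1$ at $(o'_k,r_k)$, $-1$ at $(d^0_k,l_k)$, $0$ otherwise; $\sum_k\sum_{e\in\mathcal{E}_T(a)}q_kx^k_e\le u_ay_a$ for all $a\in A_T$; $x^k_e\in\{0,1\}$ for $e\in E^k_T\cup F^k_T$; $y_a\in\mathbb{Z}_{\ge0}$ for $a\in A_T$. -}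

module Defs where

open import Algebra.Bundles using (CommutativeMonoid; CommutativeRing)
import Algebra.Properties.CommutativeMonoid.Sum as Sum
import Algebra.Properties.Monoid.Mult as Mult
open import Data.Empty using (⊥-elim-irr)
open import Data.Fin.Base as Fin using (Fin; zero; suc; toℕ; fromℕ<; inject₁)
import Data.Fin.Properties as Fin
open import Data.Integer.Base as ℤ using (ℤ; +_; -[1+_]; 0ℤ; 1ℤ; -1ℤ)
import Data.Integer.Properties as ℤ
open import Data.Irrelevant using (Irrelevant; [_])
open import Data.Nat.Base as ℕ using (ℕ; zero; suc; s≤s)
import Data.Nat.Properties as ℕ
open import Data.Product.Base using (Σ; Σ-syntax; ∃; _×_; _,_; proj₁; proj₂)
open import Data.Product.Function.Dependent.Propositional using (Σ-↔)
open import Data.Refinement using (Refinement-syntax; _,_; value; value-injective)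
open import Data.Sum.Base using (_⊎_; inj₁; inj₂)
open import Data.Sum.Function.Propositional using (_⊎-↔_)
import Data.Vec.Functional as Vector
open import Function.Base using (_∘_)
open import Function.Bundles using (_↔_; Inverse; Injection; mk↔ₛ′)
open import Function.Construct.Composition using (_↔-∘_)
open import Function.Construct.Symmetry using (↔-sym)
open import Function.Properties.Inverse using (↔⇒↣)
open import Level using (Level; 0ℓ; _⊔_) renaming (suc to lsuc)
open import Relation.Binary.Bundles using (Setoid)
open import Relation.Binary.Definitions using (DecidableEquality)
open import Relation.Binary.PropositionalEquality
  using (_≡_; _≢_; refl; sym; trans; cong; subst)
open import Relation.Binary.Structures using (IsStrictPartialOrder)
open import Relation.Nullary.Decidable
  using (Dec; yes; no; map′; via-injection; recompute; _×-dec_; _→-dec_)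
open import Relation.Nullary.Negation using (contradiction)
open import Relation.Unary using (Pred; Decidable; Satisfiable; Empty; _⊆_)

private
  variable
    X Y : Set

record Finite (X : Set) : Set where
  field
    size : ℕ
    enum : X ↔ Fin size

  elem : Fin size → X
  elem = Inverse.from enum

  infix 4 _≟_
  _≟_ : DecidableEquality X
  _≟_ = via-injection (↔⇒↣ enum) Fin._≟_

  any? : {P : Pred X 0ℓ} → Decidable P → Dec (Satisfiable P)
  any? {P} P? = map′
    (λ (i , p) → elem i , p)
    (λ (x , p) → Inverse.to enum x ,
                 subst P (sym (Inverse.strictlyInverseʳ enum x)) p)
    (Fin.any? (P? ∘ elem))

  infix 4 _⊆?_
  _⊆?_ : {P Q : Pred X 0ℓ} → Decidable P → Decidable Q → Dec (P ⊆ Q)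
  _⊆?_ {P} {Q} P? Q? = map′
    (λ h {x} → subst (λ z → P z → Q z) (Inverse.strictlyInverseʳ enum x)
                     (h (Inverse.to enum x)))
    (λ h i → h)
    (Fin.all? (λ i → P? (elem i) →-dec Q? (elem i)))

open Finite using (size; enum)

finite-↔ : X ↔ Y → Finite Y → Finite X
finite-↔ X↔Y Y-fin = record { size = size Y-fin ; enum = enum Y-fin ↔-∘ X↔Y }

finite-Fin : ∀ n → Finite (Fin n)
finite-Fin n = record { size = n ; enum = mk↔ₛ′ (λ i → i) (λ i → i) (λ _ → refl) (λ _ → refl) }

finite-⊎ : Finite X → Finite Y → Finite (X ⊎ Y)
finite-⊎ X-fin Y-fin = record
  { size = size X-fin ℕ.+ size Y-fin
  ; enum = ↔-sym Fin.+↔⊎ ↔-∘ (enum X-fin ⊎-↔ enum Y-fin)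
  }

private
  Σ-Fin : ∀ n {B : Fin n → Set} → (∀ i → Finite (B i)) → Finite (Σ (Fin n) B)
  Σ-Fin zero    B-fin = record
    { size = 0 ; enum = mk↔ₛ′ proj₁ (λ ()) (λ ()) (λ ()) }
  Σ-Fin (suc n) {B} B-fin =
    finite-↔ split (finite-⊎ (B-fin zero) (Σ-Fin n (B-fin ∘ suc)))
    where
    split : Σ (Fin (suc n)) B ↔ (B zero ⊎ Σ (Fin n) (B ∘ suc))
    split = mk↔ₛ′
      (λ { (zero , b) → inj₁ b ; (suc i , b) → inj₂ (i , b) })
      (λ { (inj₁ b) → zero , b ; (inj₂ (i , b)) → suc i , b })
      (λ { (inj₁ b) → refl ; (inj₂ (i , b)) → refl })
      (λ { (zero , b) → refl ; (suc i , b) → refl })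

  ≡⇒↔ : {A B : Set} → A ≡ B → A ↔ B
  ≡⇒↔ refl = mk↔ₛ′ (λ a → a) (λ a → a) (λ _ → refl) (λ _ → refl)

finite-Σ : {B : X → Set} → Finite X → (∀ x → Finite (B x)) → Finite (Σ X B)
finite-Σ {B = B} X-fin B-fin = finite-↔
  (Σ-↔ (enum X-fin) (≡⇒↔ (cong B (sym (Inverse.strictlyInverseʳ (enum X-fin) _)))))
  (Σ-Fin (size X-fin) (λ i → B-fin (Finite.elem X-fin i)))

finite-× : Finite X → Finite Y → Finite (X × Y)
finite-× X-fin Y-fin = finite-Σ X-fin (λ _ → Y-fin)

finite-∣ : {P : Pred X 0ℓ} → Finite X → Decidable P → Finite [ x ∈ X ∣ P x ]
finite-∣ {X} {P} X-fin P? = finite-↔ asΣ (finite-Σ X-fin (λ x → finite-Irr (P? x)))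
  where
  asΣ : [ x ∈ X ∣ P x ] ↔ Σ X (Irrelevant ∘ P)
  asΣ = mk↔ₛ′ (λ (x , p) → x , p) (λ (x , p) → x , p) (λ _ → refl) (λ _ → refl)

  finite-Irr : {A : Set} → Dec A → Finite (Irrelevant A)
  finite-Irr (yes a) = record
    { size = 1
    ; enum = mk↔ₛ′ (λ _ → zero) (λ _ → [ a ]) (λ { zero → refl }) (λ _ → refl)
    }
  finite-Irr (no ¬a) = record
    { size = 0
    ; enum = mk↔ₛ′ (λ { [ a ] → ⊥-elim-irr (¬a a) }) (λ ())
                   (λ ()) (λ { [ a ] → ⊥-elim-irr (¬a a) })
    }

module Summation {c ℓ} (M : CommutativeMonoid c ℓ) where

  ∑ : Finite X → (X → CommutativeMonoid.Carrier M) → CommutativeMonoid.Carrier M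
  ∑ X-fin f = Sum.sum M (f ∘ Finite.elem X-fin)

open Summation ℤ.+-0-commutativeMonoid using () renaming (∑ to ∑ℤ)

-- Parallel arcs and loops are not excluded: an arc is an abstract element with
-- a tail and a head.
record Digraph : Set₁ where
  field
    Node Arc    : Set
    node-finite : Finite Node
    arc-finite  : Finite Arc
    tail head   : Arc → Node

  open Finite node-finite public using () renaming (_≟_ to _≟ᴺ_)

  δ⁺ δ⁻ : Node → Set
  δ⁺ v = [ a ∈ Arc ∣ tail a ≡ v ]
  δ⁻ v = [ a ∈ Arc ∣ head a ≡ v ]

  δ⁺-finite : ∀ v → Finite (δ⁺ v)
  δ⁺-finite v = finite-∣ arc-finite (λ a → tail a ≟ᴺ v)

  δ⁻-finite : ∀ v → Finite (δ⁻ v)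
  δ⁻-finite v = finite-∣ arc-finite (λ a → head a ≟ᴺ v)

record Network : Set₁ where
  field
    digraph : Digraph
  open Digraph digraph public
  field
    τ   : Arc → ℕ
    τ>0 : ∀ a → 0 ℕ.< τ a

record Subgraph (H : Network) : Set₁ where
  open Network H
  field
    NodeIn  : Pred Node 0ℓ
    NodeIn? : Decidable NodeIn
    ArcIn   : Pred Arc 0ℓ
    ArcIn?  : Decidable ArcIn
    tail-in : ∀ {a} → ArcIn a → NodeIn (tail a)
    head-in : ∀ {a} → ArcIn a → NodeIn (head a)

  network : Network
  network = record
    { digraph = record
        { Node        = [ v ∈ Node ∣ NodeIn v ]
        ; Arc         = [ a ∈ Arc ∣ ArcIn a ]
        ; node-finite = finite-∣ node-finite NodeIn?
        ; arc-finite  = finite-∣ arc-finite ArcIn?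
        ; tail        = λ { (a , [ p ]) → tail a , [ tail-in p ] }
        ; head        = λ { (a , [ p ]) → head a , [ head-in p ] }
        }
    ; τ   = λ a → τ (value a)
    ; τ>0 = λ a → τ>0 (value a)
    }

module TimeExpansion (H : Network) (T : ℕ) where
  open Network H

  TimedNode : Set
  TimedNode = Node × Fin (suc T)

  MovementArc : Set
  MovementArc = [ (a , t) ∈ Arc × Fin (suc T) ∣ toℕ t ℕ.+ τ a ℕ.≤ T ]

  HoldoverArc : Set
  HoldoverArc = Node × Fin T

  movement-finite : Finite MovementArc
  movement-finite = finite-∣ (finite-× arc-finite (finite-Fin (suc T)))
                             (λ (a , t) → toℕ t ℕ.+ τ a ℕ.≤? T)

  timeExpanded : Digraph
  timeExpanded = record
    { Node        = TimedNode
    ; Arc         = MovementArc ⊎ HoldoverArc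
    ; node-finite = finite-× node-finite (finite-Fin (suc T))
    ; arc-finite  = finite-⊎ movement-finite (finite-× node-finite (finite-Fin T))
    ; tail        = λ { (inj₁ ((a , t) , _)) → tail a , t
                      ; (inj₂ (v , t))       → v , inject₁ t }
    ; head        = λ { (inj₁ ((a , t) , [ p ])) → head a , fromℕ< (s≤s p)
                      ; (inj₂ (v , t))           → v , suc t }
    }

open TimeExpansion using (TimedNode; MovementArc; movement-finite; timeExpanded)

TimedArc : Network → ℕ → Set
TimedArc H T = Digraph.Arc (timeExpanded H T)

-- The value of an arc variable of S_T at a movement arc of H_T; there is no
-- such variable, and it counts as 0 in sums, when the arc does not belong to S.
valueAt : ∀ {H : Network} (S : Subgraph H) {T : ℕ} →
          (TimedArc (Subgraph.network S) T → Fin 2) → MovementArc H T → ℕ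
valueAt S x ((a , t) , p) with Subgraph.ArcIn? S a
... | yes a∈S = toℕ (x (inj₁ (((a , [ a∈S ]) , t) , p)))
... | no  _   = 0

module Flow (H : Network) (T : ℕ) where
  open Network H using (Node; _≟ᴺ_)
  private module H_T = Digraph (timeExpanded H T)

  outflow inflow : (H_T.Arc → Fin 2) → H_T.Node → ℤ
  outflow x n = ∑ℤ (H_T.δ⁺-finite n) (λ a → + toℕ (x (value a)))
  inflow  x n = ∑ℤ (H_T.δ⁻-finite n) (λ a → + toℕ (x (value a)))

  -- If the two timed nodes coincide, the origin takes precedence.
  supply : (o d : Node) (r l : ℕ) → H_T.Node → ℤ
  supply o d r l (v , t) with (v ≟ᴺ o) ×-dec (toℕ t ℕ.≟ r)
                            | (v ≟ᴺ d) ×-dec (toℕ t ℕ.≟ l)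
  ... | yes _ | _     = 1ℤ
  ... | no  _ | yes _ = -1ℤ
  ... | no  _ | no  _ = 0ℤ

  Conservation : (o d : Node) (r l : ℕ) → (H_T.Arc → Fin 2) → H_T.Node → Set
  Conservation o d r l x n = outflow x n ℤ.- inflow x n ≡ supply o d r l n

-- The domain conditions of the variables are built into their types and are
-- not counted among the constraints.
record IntegerProgram {c} (C : Set c) : Set (lsuc 0ℓ ⊔ c) where
  field
    Binary            : Set
    Integral          : Set
    Constraint        : Set
    binary-finite     : Finite Binary
    integral-finite   : Finite Integral
    constraint-finite : Finite Constraint
    Holds             : Constraint → (Binary → Fin 2) → (Integral → ℕ) → Set
    objective         : (Binary → Fin 2) → (Integral → ℕ) → C

  #variables #constraints : ℕ
  #variables   = size binary-finite ℕ.+ size integral-finite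
  #constraints = size constraint-finite

  record Feasible : Set where
    constructor feasible
    field
      x         : Binary → Fin 2
      y         : Integral → ℕ
      satisfies : ∀ i → Holds i x y

  open Feasible

  feasibleSolutions : Setoid 0ℓ 0ℓ
  feasibleSolutions = record
    { Carrier       = Feasible
    ; _≈_           = λ s s′ → (∀ i → x s i ≡ x s′ i) × (∀ i → y s i ≡ y s′ i)
    ; isEquivalence = record
        { refl  = (λ _ → refl) , (λ _ → refl)
        ; sym   = λ (p , q) → (λ i → sym (p i)) , (λ i → sym (q i))
        ; trans = λ (p , q) (p′ , q′) →
            (λ i → trans (p i) (p′ i)) , (λ i → trans (q i) (q′ i))
        }
    }

  value-of : Feasible → C
  value-of s = objective (x s) (y s)

-- Covers the rationals and the reals; the order need not be decidable or total.
record OrderedCommutativeRing c ℓ₁ ℓ₂ : Set (lsuc (c ⊔ ℓ₁ ⊔ ℓ₂)) where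
  infix 4 _<_
  field
    commutativeRing : CommutativeRing c ℓ₁
  open CommutativeRing commutativeRing public
  field
    _<_                  : Carrier → Carrier → Set ℓ₂
    isStrictPartialOrder : IsStrictPartialOrder _≈_ _<_
    0<1                  : 0# < 1#
    +-monoˡ-<            : ∀ z {x y} → x < y → x + z < y + z
    *-positive           : ∀ {x y} → 0# < x → 0# < y → 0# < x * y

  open Mult +-monoid using () renaming (_×_ to _·_)

  fromℕ : ℕ → Carrier
  fromℕ n = n · 1#

  fromℤ : ℤ → Carrier
  fromℤ (+ n)    = fromℕ n
  fromℤ -[1+ n ] = - fromℕ (suc n)

record Instance {ℓ₀ ℓ₁ ℓ₂} (R : OrderedCommutativeRing ℓ₀ ℓ₁ ℓ₂)
       : Set (lsuc 0ℓ ⊔ ℓ₀ ⊔ ℓ₂) where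
  private module R = OrderedCommutativeRing R
  field
    D : Network
  open Network D public
  field
    f   : Arc → R.Carrier
    f>0 : ∀ a → R.0# R.< f a
    u   : Arc → ℕ
    u>0 : ∀ a → 0 ℕ.< u a

    K        : Set
    K-finite : Finite K
    c        : K → Arc → R.Carrier
    c>0      : ∀ k a → R.0# R.< c k a
    o d      : K → Node
    q        : K → ℤ
    r l      : K → ℕ
    earliest : ∃ λ k → r k ≡ 0

    Dᵏ : K → Subgraph D

  Nᵏ : K → Pred Node 0ℓ
  Nᵏ k = Subgraph.NodeIn (Dᵏ k)

  Aᵏ : K → Pred Arc 0ℓ
  Aᵏ k = Subgraph.ArcIn (Dᵏ k)

  δ⁺ᵏ : K → Node → Pred Arc 0ℓ
  δ⁺ᵏ k v a = Aᵏ k a × tail a ≡ v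

  δ⁺ᵏ? : ∀ k v → Decidable (δ⁺ᵏ k v)
  δ⁺ᵏ? k v a = Subgraph.ArcIn? (Dᵏ k) a ×-dec (tail a ≟ᴺ v)

  field
    o∈Nᵏ       : ∀ k → Nᵏ k (o k)
    d∈Nᵏ       : ∀ k → Nᵏ k (d k)
    δ⁺ᵏ-sink   : ∀ k → Empty (δ⁺ᵏ k (d k))
    δ⁺ᵏ-others : ∀ k v → Nᵏ k v → v ≢ d k → Satisfiable (δ⁺ᵏ k v)

  T : ℕ
  T = Vector.foldr ℕ._⊔_ 0 (l ∘ Finite.elem K-finite)

module _ {ℓ₀ ℓ₁ ℓ₂} {R : OrderedCommutativeRing ℓ₀ ℓ₁ ℓ₂} (I : Instance R) where
  private module R = OrderedCommutativeRing R
  open Instance I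
  open Summation R.+-commutativeMonoid using (∑)

  -- The parts of 𝒜_v are indexed by Fin (parts v).  The part required by
  -- `valid` is demanded only when δ⁺_{Dᵏ}(v) is nonempty: at a sink v of D the
  -- partition of δ⁺_D(v) = ∅ has no part at all.
  record ValidPartition : Set₁ where
    field
      parts     : Node → ℕ
      Part      : ∀ v → Fin (parts v) → Pred Arc 0ℓ
      Part?     : ∀ v i → Decidable (Part v i)
      part⊆δ⁺   : ∀ {v i a} → Part v i a → tail a ≡ v
      nonempty  : ∀ v i → Satisfiable (Part v i)
      covering  : ∀ a → ∃ λ i → Part (tail a) i a
      disjoint  : ∀ {v i j a} → Part v i a → Part v j a → i ≡ j
      valid     : ∀ k v → Satisfiable (δ⁺ᵏ k v) → ∃ λ i → δ⁺ᵏ k v ⊆ Part v i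

  Dⁿ : K → Network
  Dⁿ k = Subgraph.network (Dᵏ k)

  A_T : Set
  A_T = MovementArc D T

  A_T-finite : Finite A_T
  A_T-finite = movement-finite D T

  arc : A_T → Arc
  arc a = proj₁ (value a)

  Xᴰ : Set
  Xᴰ = Σ[ k ∈ K ] TimedArc (Dⁿ k) T

  xᴰ : (Xᴰ → Fin 2) → K → A_T → ℕ
  xᴰ x k = valueAt (Dᵏ k) (λ a → x (k , a))

  SND-RR-D : IntegerProgram R.Carrier
  SND-RR-D = record
    { Binary            = Xᴰ
    ; Integral          = A_T
    ; Constraint        = (Σ[ k ∈ K ] TimedNode (Dⁿ k) T) ⊎ A_T
    ; binary-finite     = finite-Σ K-finite (λ k → Digraph.arc-finite (timeExpanded (Dⁿ k) T))
    ; integral-finite   = A_T-finite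
    ; constraint-finite = finite-⊎
        (finite-Σ K-finite (λ k → Digraph.node-finite (timeExpanded (Dⁿ k) T)))
        A_T-finite
    ; Holds             = λ
        { (inj₁ (k , n)) x y →
            Flow.Conservation (Dⁿ k) T
              (o k , [ o∈Nᵏ k ]) (d k , [ d∈Nᵏ k ]) (r k) (l k) (λ a → x (k , a)) n
        ; (inj₂ a) x y →
            ∑ℤ K-finite (λ k → q k ℤ.* + xᴰ x k a) ℤ.≤ + (u (arc a) ℕ.* y a)
        }
    ; objective         = λ x y →
        ∑ A_T-finite (λ a → f (arc a) R.* R.fromℕ (y a))
        R.+ ∑ A_T-finite (λ a → ∑ K-finite (λ k →
              c k (arc a) R.* R.fromℤ (q k) R.* R.fromℕ (xᴰ x k a)))
    }

  module Auxiliary (𝒜 : ValidPartition) where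
    open ValidPartition 𝒜

    -- (v , zero) is the terminal copy v⁰; (v , suc i) is the copy of the part i.
    V : Set
    V = Σ[ v ∈ Node ] Fin (suc (parts v))

    -- (a , i , j) is the arc vⁱwʲ, for a = vw.
    E : Set
    E = [ (a , i , j) ∈ Σ[ a ∈ Arc ] Fin (parts (tail a)) × Fin (suc (parts (head a)))
        ∣ Part (tail a) i a ]

    baseArc : E → Arc
    baseArc e = proj₁ (value e)

    G : Network
    G = record
      { digraph = record
          { Node        = V
          ; Arc         = E
          ; node-finite = finite-Σ node-finite (λ v → finite-Fin (suc (parts v)))
          ; arc-finite  = finite-∣
              (finite-Σ arc-finite (λ a →
                finite-× (finite-Fin (parts (tail a))) (finite-Fin (suc (parts (head a))))))
              (λ (a , i , j) → Part? (tail a) i a)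
          ; tail        = λ ((a , i , j) , _) → tail a , suc i
          ; head        = λ ((a , i , j) , _) → head a , j
          }
      ; τ   = τ ∘ baseArc
      ; τ>0 = τ>0 ∘ baseArc
      }

    private module G = Network G

    InK : ∀ v → Fin (parts v) → Pred K 0ℓ
    InK v i k = Satisfiable (δ⁺ᵏ k v) × δ⁺ᵏ k v ⊆ Part v i

    InK? : ∀ v i → Decidable (InK v i)
    InK? v i k = Finite.any? arc-finite (δ⁺ᵏ? k v)
                 ×-dec Finite._⊆?_ arc-finite (δ⁺ᵏ? k v) (Part? v i)

    Vᵏ : K → Pred V 0ℓ
    Vᵏ k (v , zero)  = v ≡ d k
    Vᵏ k (v , suc i) = Nᵏ k v × InK v i k

    Vᵏ? : ∀ k → Decidable (Vᵏ k)
    Vᵏ? k (v , zero)  = v ≟ᴺ d k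
    Vᵏ? k (v , suc i) = Subgraph.NodeIn? (Dᵏ k) v ×-dec InK? v i k

    Eᵏ : K → Pred E 0ℓ
    Eᵏ k e = Aᵏ k (baseArc e) × Vᵏ k (G.tail e) × Vᵏ k (G.head e)

    Gᵏ : K → Subgraph G
    Gᵏ k = record
      { NodeIn  = Vᵏ k
      ; NodeIn? = Vᵏ? k
      ; ArcIn   = Eᵏ k
      ; ArcIn?  = λ e → Subgraph.ArcIn? (Dᵏ k) (baseArc e)
                        ×-dec Vᵏ? k (G.tail e) ×-dec Vᵏ? k (G.head e)
      ; tail-in = λ (_ , t , _) → t
      ; head-in = λ (_ , _ , h) → h
      }

    Gⁿ : K → Network
    Gⁿ k = Subgraph.network (Gᵏ k)

    d⁰ : ∀ k → Network.Node (Gⁿ k)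
    d⁰ k = (d k , zero) , [ refl ]

    o′ : ∀ k → Network.Node (Gⁿ k)
    o′ k with o k ≟ᴺ d k
    ... | yes o≡d = (o k , zero) , [ o≡d ]
    ... | no  o≢d = (o k , suc (proj₁ part)) , [ o∈Nᵏ k , nonempty-δ , proj₂ part ]
      where
      nonempty-δ : Satisfiable (δ⁺ᵏ k (o k))
      nonempty-δ = δ⁺ᵏ-others k (o k) (o∈Nᵏ k) o≢d
      part : ∃ λ i → δ⁺ᵏ k (o k) ⊆ Part (o k) i
      part = valid k (o k) nonempty-δ

    Vᵏ-unique : ∀ k v {i j} → Vᵏ k (v , i) → Vᵏ k (v , j) → i ≡ j
    Vᵏ-unique k v {zero}  {zero}  _    _    = refl
    Vᵏ-unique k v {zero}  {suc j} refl (_ , (a , a∈) , _) =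
      contradiction a∈ (δ⁺ᵏ-sink k a)
    Vᵏ-unique k v {suc i} {zero}  (_ , (a , a∈) , _) refl =
      contradiction a∈ (δ⁺ᵏ-sink k a)
    Vᵏ-unique k v {suc i} {suc j} (_ , (_ , a∈) , ⊆i) (_ , _ , ⊆j) =
      cong suc (disjoint (⊆i a∈) (⊆j a∈))

    o′-copy : ∀ k → proj₁ (value (o′ k)) ≡ o k
    o′-copy k with o k ≟ᴺ d k
    ... | yes _ = refl
    ... | no  _ = refl

    o′-unique : ∀ k (v : Network.Node (Gⁿ k)) → proj₁ (value v) ≡ o k → v ≡ o′ k
    o′-unique k ((v , i) , [ p ]) v≡o = go (o′ k) (trans v≡o (sym (o′-copy k)))
      where
      go : ∀ (w : Network.Node (Gⁿ k)) → v ≡ proj₁ (value w) → ((v , i) , [ p ]) ≡ w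
      go ((_ , j) , [ p′ ]) refl = value-injective (cong (v ,_)
        (recompute (i Fin.≟ j) (Vᵏ-unique k v p p′)))

    E_T : Set
    E_T = MovementArc G T

    E_T-finite : Finite E_T
    E_T-finite = movement-finite G T

    base : E_T → A_T
    base ((e , t) , p) = (baseArc e , t) , p

    ℰ_T : A_T → Set
    ℰ_T a = [ e ∈ E_T ∣ base e ≡ a ]

    ℰ_T-finite : ∀ a → Finite (ℰ_T a)
    ℰ_T-finite a = finite-∣ E_T-finite (λ e → Finite._≟_ A_T-finite (base e) a)

    Xᴳ : Set
    Xᴳ = Σ[ k ∈ K ] TimedArc (Gⁿ k) T

    xᴳ : (Xᴳ → Fin 2) → K → E_T → ℕ
    xᴳ x k = valueAt (Gᵏ k) (λ e → x (k , e))

    SND-RR-G : IntegerProgram R.Carrier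
    SND-RR-G = record
      { Binary            = Xᴳ
      ; Integral          = A_T
      ; Constraint        = (Σ[ k ∈ K ] TimedNode (Gⁿ k) T) ⊎ A_T
      ; binary-finite     = finite-Σ K-finite (λ k → Digraph.arc-finite (timeExpanded (Gⁿ k) T))
      ; integral-finite   = A_T-finite
      ; constraint-finite = finite-⊎
          (finite-Σ K-finite (λ k → Digraph.node-finite (timeExpanded (Gⁿ k) T)))
          A_T-finite
      ; Holds             = λ
          { (inj₁ (k , n)) x y →
              Flow.Conservation (Gⁿ k) T (o′ k) (d⁰ k) (r k) (l k) (λ e → x (k , e)) n
          ; (inj₂ a) x y →
              ∑ℤ K-finite (λ k → ∑ℤ (ℰ_T-finite a) (λ e → q k ℤ.* + xᴳ x k (value e)))
                ℤ.≤ + (u (arc a) ℕ.* y a)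
          }
      ; objective         = λ x y →
          ∑ A_T-finite (λ a → f (arc a) R.* R.fromℕ (y a))
          R.+ ∑ K-finite (λ k → ∑ E_T-finite (λ e →
                c k (arc (base e)) R.* R.fromℤ (q k) R.* R.fromℕ (xᴳ x k e)))
      }

  open Auxiliary public using (SND-RR-G)

{-# OPTIONS --safe #-}
-- Every node v of Dᵏ has exactly one copy in Vᵏ: the terminal copy if v = d_k,
-- and otherwise the copy of the part containing δ⁺_{Dᵏ}(v).  Hence v ↦ copy of v
-- is an isomorphism Dᵏ ≅ Gᵏ preserving transit times, which lifts to the
-- time-expanded networks and identifies the flow variables and the conservation
-- constraints.  The sum over ℰ_T(a) in a capacity constraint of G_T has at most
-- one nonzero term for each commodity, the variable of the lift of a.
module Submission where

open import Defs
open import Algebra.Bundles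
  using (CommutativeMonoid; CommutativeRing; CommutativeSemiring; Semiring;
         SemiringWithoutAnnihilatingZero)
import Algebra.Properties.CommutativeMonoid.Sum as Sum
open import Data.Bool.Base using (if_then_else_)
open import Data.Empty using (⊥-elim-irr)
open import Data.Fin.Base using (Fin; zero; suc; toℕ; punchIn)
open import Data.Fin.Permutation using (↔⇒≡)
import Data.Fin.Properties as Fin
open import Data.Integer.Base as ℤ using (ℤ; +_; 0ℤ)
import Data.Integer.Properties as ℤ
open import Data.Irrelevant using ([_])
open import Data.Nat.Base as ℕ using (ℕ; suc)
import Data.Nat.Properties as ℕ
open import Data.Product.Base using (Σ-syntax; ∃; _×_; _,_; proj₁; proj₂)
open import Data.Product.Function.Dependent.Propositional using (Σ-↔)
open import Data.Refinement using (Refinement-syntax; _,_; value; value-injective)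
open import Data.Sum.Base using (inj₁; inj₂)
open import Data.Sum.Function.Propositional using (_⊎-↔_)
open import Function.Base using (_∘_; id)
open import Function.Bundles using (Bijection; Inverse; Injection; _↔_; mk↔ₛ′)
open import Function.Construct.Composition using (_↔-∘_)
open import Function.Construct.Identity using (↔-id)
open import Function.Construct.Symmetry using (↔-sym)
open import Function.Definitions using (Injective)
open import Function.Properties.Inverse using (↔⇒↣)
open import Level using (0ℓ; _⊔_) renaming (suc to lsuc)
open import Relation.Binary.Core using (Rel)
open import Relation.Binary.Definitions using (DecidableEquality)
open import Relation.Binary.PropositionalEquality
  using (_≡_; _≢_; refl; sym; trans; cong; cong₂; subst)
import Relation.Binary.Reasoning.Setoid as ≈-Reasoning
open import Relation.Nullary.Decidable using (Dec; does; yes; no; recompute; _×-dec_)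
open import Relation.Nullary.Negation using (¬_; contradiction)
open import Relation.Unary using (Satisfiable; _⊆_)
open IntegerProgram using (#variables; #constraints; feasibleSolutions; value-of)

-- Bijections of finite types and sums in commutative monoids.

private
  variable
    X Y : Set

↔-injective : (β : X ↔ Y) → Injective _≡_ _≡_ (Inverse.to β)
↔-injective β = Injection.injective (↔⇒↣ β)

-- Conjugating with the two enumerations gives a bijection of `Fin m` with `Fin n`, which forces m =
-- n. Counting variables and constraints thus reduces to bijections of their index types.
size-cong : X ↔ Y → (X-fin : Finite X) (Y-fin : Finite Y) →
            Finite.size X-fin ≡ Finite.size Y-fin
size-cong β X-fin Y-fin =
  ↔⇒≡ (Finite.enum Y-fin ↔-∘ (β ↔-∘ ↔-sym (Finite.enum X-fin)))

module SummationProperties {c ℓ} (M : CommutativeMonoid c ℓ) where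

  private module M = CommutativeMonoid M
  open M using (Carrier; _≈_; _∙_; ∙-congˡ; identityʳ) renaming (ε to 0#)
  open Summation M
  open ≈-Reasoning M.setoid

  sum-single : ∀ {n} (t : Fin n → Carrier) i → (∀ j → j ≢ i → t j ≈ 0#) →
               Sum.sum M t ≈ t i
  sum-single {suc n} t i zeros = begin
    Sum.sum M t                             ≈⟨ Sum.sum-remove M {i = i} t ⟩
    t i ∙ Sum.sum M (λ j → t (punchIn i j)) ≈⟨ ∙-congˡ (Sum.sum-cong-≋ M (λ j → zeros _ (Fin.punchInᵢ≢i i j))) ⟩
    t i ∙ Sum.sum M {n} (λ _ → 0#)          ≈⟨ ∙-congˡ (Sum.sum-replicate-zero M n) ⟩
    t i ∙ 0#                                ≈⟨ identityʳ (t i) ⟩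
    t i                                     ∎

  module _ (X-fin : Finite X) where

    ∑-cong : {f g : X → Carrier} → (∀ x → f x ≈ g x) → ∑ X-fin f ≈ ∑ X-fin g
    ∑-cong f≈g = Sum.sum-cong-≋ M (λ i → f≈g (Finite.elem X-fin i))

    ∑-zero : {f : X → Carrier} → (∀ x → f x ≈ 0#) → ∑ X-fin f ≈ 0#
    ∑-zero f≈0 = M.trans (∑-cong f≈0) (Sum.sum-replicate-zero M (Finite.size X-fin))

    ∑-single : (f : X → Carrier) (x : X) → (∀ x′ → x′ ≢ x → f x′ ≈ 0#) →
               ∑ X-fin f ≈ f x
    ∑-single f x zeros = begin
      ∑ X-fin f       ≈⟨ sum-single _ (to x) (λ i i≢x → zeros _ (λ eq →
                           i≢x (trans (sym (strictlyInverseˡ i)) (cong to eq)))) ⟩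
      f (from (to x)) ≡⟨ cong f (strictlyInverseʳ x) ⟩
      f x             ∎
      where
      open Inverse (Finite.enum X-fin)

  ∑-swap : (X-fin : Finite X) (Y-fin : Finite Y) (f : X → Y → Carrier) →
           ∑ X-fin (λ x → ∑ Y-fin (f x)) ≈ ∑ Y-fin (λ y → ∑ X-fin (λ x → f x y))
  ∑-swap X-fin Y-fin f =
    Sum.∑-comm M (λ i j → f (Finite.elem X-fin i) (Finite.elem Y-fin j))

  when : {A : Set} → Dec A → Carrier → Carrier
  when A? z = if does A? then z else 0#

  when-yes : {A : Set} (A? : Dec A) (z : Carrier) → A → when A? z ≈ z
  when-yes (yes _) _ _ = M.refl
  when-yes (no ¬a) _ a = contradiction a ¬a

  when-no : {A : Set} (A? : Dec A) (z : Carrier) → ¬ A → when A? z ≈ 0#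
  when-no (yes a) _ ¬a = contradiction a ¬a
  when-no (no _)  _ _  = M.refl

  -- Double counting of the terms with ι x = y.
  ∑-reindex : (X-fin : Finite X) (Y-fin : Finite Y) (ι : X → Y) → Injective _≡_ _≡_ ι →
              (g : Y → Carrier) → (∀ y → (∀ x → ι x ≢ y) → g y ≈ 0#) →
              ∑ X-fin (g ∘ ι) ≈ ∑ Y-fin g
  ∑-reindex {X} {Y} X-fin Y-fin ι ι-injective g g-zero = begin
    ∑ X-fin (g ∘ ι)                                         ≈⟨ ∑-cong X-fin row ⟨
    ∑ X-fin (λ x → ∑ Y-fin (λ y → when (ι x ≟ y) (g y)))    ≈⟨ ∑-swap X-fin Y-fin (λ x y → when (ι x ≟ y) (g y)) ⟩
    ∑ Y-fin (λ y → ∑ X-fin (λ x → when (ι x ≟ y) (g y)))    ≈⟨ ∑-cong Y-fin column ⟩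
    ∑ Y-fin g                                               ∎
    where
    open Finite Y-fin using (_≟_)

    row : ∀ x → ∑ Y-fin (λ y → when (ι x ≟ y) (g y)) ≈ g (ι x)
    row x = M.trans
      (∑-single Y-fin (λ y → when (ι x ≟ y) (g y)) (ι x) (λ y y≢ → when-no (ι x ≟ y) _ (y≢ ∘ sym)))
      (when-yes (ι x ≟ ι x) _ refl)

    column : ∀ y → ∑ X-fin (λ x → when (ι x ≟ y) (g y)) ≈ g y
    column y with Finite.any? X-fin (λ x → ι x ≟ y)
    ... | yes (x , ιx≡y) = M.trans
      (∑-single X-fin (λ x → when (ι x ≟ y) (g y)) x (λ x′ x′≢x → when-no (ι x′ ≟ y) _
        (λ ιx′≡y → x′≢x (ι-injective (trans ιx′≡y (sym ιx≡y))))))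
      (when-yes (ι x ≟ y) _ ιx≡y)
    ... | no ¬image = M.trans
      (∑-zero X-fin (λ x → when-no (ι x ≟ y) _ (λ eq → ¬image (x , eq))))
      (M.sym (g-zero y (λ x eq → ¬image (x , eq))))

module ∑ℤ = SummationProperties ℤ.+-0-commutativeMonoid

-- Isomorphisms of digraphs and sums over incident arcs.

record _≅_ (H H′ : Digraph) : Set where
  private
    module H  = Digraph H
    module H′ = Digraph H′
  field
    node-↔ : H.Node ↔ H′.Node
    arc-↔  : H.Arc ↔ H′.Arc

  node : H.Node → H′.Node
  node = Inverse.to node-↔

  arcTo : H.Arc → H′.Arc
  arcTo = Inverse.to arc-↔

  field
    tail-to : ∀ a → H′.tail (arcTo a) ≡ node (H.tail a)
    head-to : ∀ a → H′.head (arcTo a) ≡ node (H.head a)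

module _ {H H′ : Digraph} (φ : H ≅ H′)
         (x : Digraph.Arc H → ℤ) (x′ : Digraph.Arc H′ → ℤ) where
  open _≅_ φ
  private
    module H  = Digraph H
    module H′ = Digraph H′
  open Summation ℤ.+-0-commutativeMonoid using (∑)

  -- With `end` the tail or the head this serves both outflow and inflow. The arc bijection
  -- restricts to the arcs incident to `n`, so the sums agree by reindexing, whatever the
  -- enumerations.
  incident-sum :
    (end : H.Arc → H.Node) (end′ : H′.Arc → H′.Node) →
    (∀ a → end′ (arcTo a) ≡ node (end a)) →
    ∀ n (fin  : Finite [ a ∈ H.Arc ∣ end a ≡ n ])
        (fin′ : Finite [ a ∈ H′.Arc ∣ end′ a ≡ node n ]) →
    (∀ a → x a ≡ x′ (arcTo a)) →
    ∑ fin (λ a → x (value a)) ≡ ∑ fin′ (λ a → x′ (value a))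
  incident-sum end end′ end-to n fin fin′ x≗x′ = trans
    (∑ℤ.∑-cong fin (λ a → x≗x′ (value a)))
    (∑ℤ.∑-reindex fin fin′ ι ι-injective (λ a → x′ (value a)) (λ b b∉ →
      contradiction (ι-from b) (b∉ (pre b))))
    where
    open Inverse arc-↔ using (from; strictlyInverseˡ)

    ι : [ a ∈ H.Arc ∣ end a ≡ n ] → [ a ∈ H′.Arc ∣ end′ a ≡ node n ]
    ι (a , [ p ]) = arcTo a , [ trans (end-to a) (cong node p) ]

    ι-injective : Injective _≡_ _≡_ ι
    ι-injective eq = value-injective (↔-injective arc-↔ (cong value eq))

    pre : [ a ∈ H′.Arc ∣ end′ a ≡ node n ] → [ a ∈ H.Arc ∣ end a ≡ n ]
    -- Injectivity of `node` is what puts the preimage of an arc at `node n` back at `n`.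
    pre (b , [ p ]) = from b , [ ↔-injective node-↔
      (trans (sym (end-to (from b))) (trans (cong end′ (strictlyInverseˡ b)) p)) ]

    ι-from : ∀ b → ι (pre b) ≡ b
    ι-from b = value-injective (strictlyInverseˡ (value b))

-- Lifting network isomorphisms to time-expanded networks.

record _≅ᴺ_ (H H′ : Network) : Set where
  field
    digraph-≅ : Network.digraph H ≅ Network.digraph H′
  open _≅_ digraph-≅ public
  field
    τ-to : ∀ a → Network.τ H′ (arcTo a) ≡ Network.τ H a

module _ {H H′ : Network} (φ : H ≅ᴺ H′) (T : ℕ) where
  open _≅ᴺ_ φ
  private
    module H  = Network H
    module H′ = Network H′
    H*  = TimeExpansion.timeExpanded H T
    H′* = TimeExpansion.timeExpanded H′ T

  timedNode-↔ : TimeExpansion.TimedNode H T ↔ TimeExpansion.TimedNode H′ T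
  timedNode-↔ = mk↔ₛ′ (λ (v , t) → node v , t) (λ (v , t) → Inverse.from node-↔ v , t)
    (λ (v , t) → cong (_, t) (Inverse.strictlyInverseˡ node-↔ v))
    (λ (v , t) → cong (_, t) (Inverse.strictlyInverseʳ node-↔ v))

  movementArc-↔ : TimeExpansion.MovementArc H T ↔ TimeExpansion.MovementArc H′ T
  movementArc-↔ = mk↔ₛ′
    (λ { ((a , t) , [ p ]) →
         (arcTo a , t) , [ subst (λ n → toℕ t ℕ.+ n ℕ.≤ T) (sym (τ-to a)) p ] })
    (λ { ((b , t) , [ p ]) →
         (from b , t) , [ subst (λ n → toℕ t ℕ.+ n ℕ.≤ T) (sym (τ-from b)) p ] })
    (λ { ((b , t) , _) → value-injective (cong (_, t) (strictlyInverseˡ b)) })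
    (λ { ((a , t) , _) → value-injective (cong (_, t) (strictlyInverseʳ a)) })
    where
    open Inverse arc-↔ using (from; strictlyInverseˡ; strictlyInverseʳ)
    τ-from : ∀ b → H.τ (from b) ≡ H′.τ b
    τ-from b = trans (sym (τ-to (from b))) (cong H′.τ (strictlyInverseˡ b))

  holdoverArc-↔ : TimeExpansion.HoldoverArc H T ↔ TimeExpansion.HoldoverArc H′ T
  holdoverArc-↔ = mk↔ₛ′ (λ (v , t) → node v , t) (λ (v , t) → Inverse.from node-↔ v , t)
    (λ (v , t) → cong (_, t) (Inverse.strictlyInverseˡ node-↔ v))
    (λ (v , t) → cong (_, t) (Inverse.strictlyInverseʳ node-↔ v))

  timeExpanded-≅ : TimeExpansion.timeExpanded H T ≅ TimeExpansion.timeExpanded H′ T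
  timeExpanded-≅ = record
    { node-↔  = timedNode-↔
    ; arc-↔   = movementArc-↔ ⊎-↔ holdoverArc-↔
    ; tail-to = λ { (inj₁ ((a , t) , _)) → cong (_, t) (tail-to a)
                  ; (inj₂ _)             → refl }
    ; head-to = λ { (inj₁ ((a , t) , _)) → cong₂ _,_ (head-to a)
                      -- The two arrival times come from different bounds on possibly different
                      -- expressions; they agree because transit times are preserved.
                      (Fin.fromℕ<-cong _ _ (cong (λ n → toℕ t ℕ.+ n) (τ-to a)) _ _)
                  ; (inj₂ _)             → refl }
    }

  -- Time is unchanged and `node` is injective, so each test succeeds in `H` exactly when it does in
  -- `H′`. The mixed cases are contradictory.
  supply-≅ : ∀ o d r l n → Flow.supply H T o d r l n ≡
             Flow.supply H′ T (node o) (node d) r l (_≅_.node timeExpanded-≅ n)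
  supply-≅ o d r l (v , t)
    with (v H.≟ᴺ o) ×-dec (toℕ t ℕ.≟ r) | (v H.≟ᴺ d) ×-dec (toℕ t ℕ.≟ l)
       | (node v H′.≟ᴺ node o) ×-dec (toℕ t ℕ.≟ r) | (node v H′.≟ᴺ node d) ×-dec (toℕ t ℕ.≟ l)
  ... | yes _       | _           | yes _       | _     = refl
  ... | yes (p , q) | _           | no ¬o       | _     = contradiction (cong node p , q) ¬o
  ... | no ¬o       | _           | yes (p , q) | _     = contradiction (↔-injective node-↔ p , q) ¬o
  ... | no _        | yes _       | no _        | yes _ = refl
  ... | no _        | yes (p , q) | no _        | no ¬d = contradiction (cong node p , q) ¬d
  ... | no _        | no ¬d       | no _        | yes (p , q) = contradiction (↔-injective node-↔ p , q) ¬d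
  ... | no _        | no _        | no _        | no _  = refl

  difference-≡ : {a a′ b b′ s s′ : ℤ} → a ≡ a′ → b ≡ b′ → s ≡ s′ →
                 (a ℤ.- b ≡ s) ≡ (a′ ℤ.- b′ ≡ s′)
  difference-≡ refl refl refl = refl

  module _ {x : TimedArc H T → Fin 2} {x′ : TimedArc H′ T → Fin 2}
           (x≗x′ : ∀ a → x a ≡ x′ (_≅_.arcTo timeExpanded-≅ a)) where

    outflow-≅ : ∀ n → Flow.outflow H T x n ≡ Flow.outflow H′ T x′ (_≅_.node timeExpanded-≅ n)
    outflow-≅ n = incident-sum timeExpanded-≅ (λ a → + toℕ (x a)) (λ a → + toℕ (x′ a))
      (Digraph.tail H*) (Digraph.tail H′*) (_≅_.tail-to timeExpanded-≅)
      n (Digraph.δ⁺-finite H* n) (Digraph.δ⁺-finite H′* (_≅_.node timeExpanded-≅ n))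
      (λ a → cong (λ i → + toℕ i) (x≗x′ a))

    inflow-≅ : ∀ n → Flow.inflow H T x n ≡ Flow.inflow H′ T x′ (_≅_.node timeExpanded-≅ n)
    inflow-≅ n = incident-sum timeExpanded-≅ (λ a → + toℕ (x a)) (λ a → + toℕ (x′ a))
      (Digraph.head H*) (Digraph.head H′*) (_≅_.head-to timeExpanded-≅)
      n (Digraph.δ⁻-finite H* n) (Digraph.δ⁻-finite H′* (_≅_.node timeExpanded-≅ n))
      (λ a → cong (λ i → + toℕ i) (x≗x′ a))

    -- The origin and destination in `H′` are variables tied by equations, because those of the
    -- auxiliary network are only propositionally the images of the original ones. The conclusion is
    -- an equality of types, so it transports satisfaction in both directions.
    conservation-≅ : ∀ o d {o′ d′} → node o ≡ o′ → node d ≡ d′ →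
      ∀ r l n n′ → _≅_.node timeExpanded-≅ n ≡ n′ →
      Flow.Conservation H T o d r l x n ≡ Flow.Conservation H′ T o′ d′ r l x′ n′
    conservation-≅ o d {o′} {d′} refl refl r l n n′ n↦n′ = trans
      (difference-≡
        {outflow H T x n} {outflow H′ T x′ (_≅_.node timeExpanded-≅ n)}
        {inflow H T x n} {inflow H′ T x′ (_≅_.node timeExpanded-≅ n)}
        (outflow-≅ n) (inflow-≅ n) (supply-≅ o d r l n))
      (cong (Flow.Conservation H′ T o′ d′ r l x′) {_≅_.node timeExpanded-≅ n} {n′} n↦n′)
      where open Flow using (outflow; inflow)

-- Arc variables of a subgraph read on the whole network.

module _ {H : Network} (S : Subgraph H) {T : ℕ} where
  open Subgraph S

  inclusion : TimeExpansion.MovementArc network T → TimeExpansion.MovementArc H T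
  inclusion (((a , _) , t) , p) = (a , t) , p

  inclusion-injective : Injective _≡_ _≡_ inclusion
  inclusion-injective refl = refl

  module _ (x : TimedArc network T → Fin 2) where

    -- The decision procedure may return another membership proof than the one stored in `m`;
    -- membership is irrelevant, so both name the same variable.
    valueAt-inclusion : ∀ m → valueAt S x (inclusion m) ≡ toℕ (x (inj₁ m))
    valueAt-inclusion (((a , [ a∈S ]) , t) , p) with ArcIn? a
    ... | yes _   = refl
    ... | no  a∉S = ⊥-elim-irr (a∉S a∈S)

    valueAt-∉ : ∀ n → (∀ m → inclusion m ≢ n) → valueAt S x n ≡ 0
    valueAt-∉ ((a , t) , p) n∉ with ArcIn? a
    ... | yes a∈S = contradiction refl (n∉ (((a , [ a∈S ]) , t) , p))
    ... | no  _   = refl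

    module _ {c ℓ} (M : CommutativeMonoid c ℓ) where
      private module M = CommutativeMonoid M
      open Summation M
      open SummationProperties M

      -- Arcs outside the subgraph are read as 0, and `g n 0` vanishes, so they add nothing. The
      -- first argument of `g` leaves room for coefficients depending on the arc.
      ∑-valueAt : (S-fin : Finite (TimeExpansion.MovementArc network T))
        (H-fin : Finite (TimeExpansion.MovementArc H T))
        (g : TimeExpansion.MovementArc H T → ℕ → M.Carrier) → (∀ n → g n 0 M.≈ M.ε) →
        ∑ S-fin (λ m → g (inclusion m) (toℕ (x (inj₁ m)))) M.≈ ∑ H-fin (λ n → g n (valueAt S x n))
      ∑-valueAt S-fin H-fin g g-zero = M.trans
        (∑-cong S-fin (λ m → M.reflexive (cong (g (inclusion m)) (sym (valueAt-inclusion m)))))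
        (∑-reindex S-fin H-fin inclusion inclusion-injective (λ n → g n (valueAt S x n))
          (λ n n∉ → M.trans (M.reflexive (cong (g n) (valueAt-∉ n n∉))) (g-zero n)))

-- The isomorphism of each commodity network with its auxiliary copy.

module _ {ℓ₀ ℓ₁ ℓ₂} {R : OrderedCommutativeRing ℓ₀ ℓ₁ ℓ₂} (I : Instance R) (𝒜 : ValidPartition I) where
  open Instance I
  open ValidPartition 𝒜
  open Auxiliary I 𝒜

  module _ (k : K) where
    private
      module Dᵏ = Subgraph (Dᵏ k)
      module Gᵏ = Network (Gⁿ k)

    -- Away from `d k`, `δ⁺ᵏ-others` provides the outgoing arc that `valid` requires. At `d k` there
    -- is none, and the terminal copy takes over.
    copyIndex : ∀ v → Nᵏ k v → ∃ λ i → Vᵏ k (v , i)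
    copyIndex v v∈ with v ≟ᴺ d k
    ... | yes v≡d = zero , v≡d
    ... | no  v≢d = suc (proj₁ part) , v∈ , nonempty-δ , proj₂ part
      where
      nonempty-δ : Satisfiable (δ⁺ᵏ k v)
      nonempty-δ = δ⁺ᵏ-others k v v∈ v≢d
      part : ∃ λ i → δ⁺ᵏ k v ⊆ Part v i
      part = valid k v nonempty-δ

    Vᵏ⇒Nᵏ : ∀ v i → Vᵏ k (v , i) → Nᵏ k v
    Vᵏ⇒Nᵏ v zero    refl     = d∈Nᵏ k
    Vᵏ⇒Nᵏ v (suc i) (v∈ , _) = v∈

    -- This is the uniqueness of copies, `Vᵏ-unique`. Membership is irrelevant, so the equality of
    -- indices is recovered through its decidability.
    Gᵏ-node-≡ : (v w : Gᵏ.Node) → proj₁ (value v) ≡ proj₁ (value w) → v ≡ w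
    Gᵏ-node-≡ ((v , i) , [ p ]) ((_ , j) , [ p′ ]) refl = value-injective
      (cong (v ,_) (recompute (i Fin.≟ j) (Vᵏ-unique k v p p′)))

    -- Both indices of an auxiliary arc are copies of its ends lying in `Vᵏ`, hence unique. On the
    -- tail side, part `i` is the copy `suc i`, whence `Fin.suc-injective`.
    Gᵏ-arc-≡ : (e e′ : Gᵏ.Arc) → baseArc (value e) ≡ baseArc (value e′) → e ≡ e′
    Gᵏ-arc-≡ (((a , i , j) , _) , [ p ]) (((_ , i′ , j′) , _) , [ p′ ]) refl =
      value-injective (value-injective (cong₂ (λ i j → a , i , j)
        (recompute (i Fin.≟ i′)
          (Fin.suc-injective (Vᵏ-unique k (tail a) (proj₁ (proj₂ p)) (proj₁ (proj₂ p′)))))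
        (recompute (j Fin.≟ j′)
          (Vᵏ-unique k (head a) (proj₂ (proj₂ p)) (proj₂ (proj₂ p′))))))

    copy : Network.Node (Dⁿ I k) → Gᵏ.Node
    copy (v , [ p ]) = (v , proj₁ i) , [ proj₂ i ]
      where i = copyIndex v (recompute (Dᵏ.NodeIn? v) p)

    -- The tail index must be a part, never the terminal copy, so it is taken from `valid` with the
    -- arc itself as witness of nonemptiness, not from `copyIndex`. That it agrees with `copy` of
    -- the tail follows from uniqueness of copies.
    arcCopy : Network.Arc (Dⁿ I k) → Gᵏ.Arc
    arcCopy (a , [ p ]) =
      ((a , proj₁ part , proj₁ j) , [ proj₂ part (a∈ , refl) ]) ,
      [ a∈ , (Dᵏ.tail-in a∈ , nonempty-δ , proj₂ part) , proj₂ j ]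
      where
      a∈ : Aᵏ k a
      a∈ = recompute (Dᵏ.ArcIn? a) p
      nonempty-δ : Satisfiable (δ⁺ᵏ k (tail a))
      nonempty-δ = a , a∈ , refl
      part : ∃ λ i → δ⁺ᵏ k (tail a) ⊆ Part (tail a) i
      part = valid k (tail a) nonempty-δ
      j : ∃ λ j → Vᵏ k (head a , j)
      j = copyIndex (head a) (Dᵏ.head-in a∈)

    -- The inverse forgets the copy indices. All laws then compare base nodes or base arcs, which
    -- coincide definitionally.
    Dᵏ≅Gᵏ : Dⁿ I k ≅ᴺ Auxiliary.Gⁿ I 𝒜 k
    Dᵏ≅Gᵏ = record
      { digraph-≅ = record
          { node-↔ = mk↔ₛ′ copy
              (λ { ((v , i) , [ p ]) → v , [ Vᵏ⇒Nᵏ v i p ] })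
              (λ w → Gᵏ-node-≡ _ w refl)
              (λ _ → refl)
          ; arc-↔ = mk↔ₛ′ arcCopy
              (λ { (e , [ p ]) → baseArc e , [ proj₁ p ] })
              (λ e → Gᵏ-arc-≡ _ e refl)
              (λ _ → refl)
          ; tail-to = λ _ → Gᵏ-node-≡ _ _ refl
          ; head-to = λ _ → Gᵏ-node-≡ _ _ refl
          }
      ; τ-to = λ _ → refl
      }

    copy-o : copy (o k , [ o∈Nᵏ k ]) ≡ o′ k
    copy-o = Gᵏ-node-≡ _ _ (sym (o′-copy k))

    copy-d : copy (d k , [ d∈Nᵏ k ]) ≡ d⁰ k
    copy-d = Gᵏ-node-≡ _ _ refl

-- Equivalence of integer programs through bijections of their indices.

module ProgramEquivalence {c ℓ} {C : Set c} {_≈_ : Rel C ℓ} (P Q : IntegerProgram C) where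
  private
    module P = IntegerProgram P
    module Q = IntegerProgram Q

  record Equivalence : Set (c ⊔ ℓ ⊔ lsuc 0ℓ) where
    field
      binary-↔     : P.Binary ↔ Q.Binary
      integral-↔   : P.Integral ↔ Q.Integral
      constraint-↔ : P.Constraint ↔ Q.Constraint

    -- Solutions are related pointwise, so that the same laws apply to transport in either direction
    -- without function extensionality.
    Corresponds : (P.Binary → Fin 2) → (P.Integral → ℕ) →
                  (Q.Binary → Fin 2) → (Q.Integral → ℕ) → Set
    Corresponds x y x′ y′ = (∀ b → x b ≡ x′ (Inverse.to binary-↔ b)) ×
                            (∀ j → y j ≡ y′ (Inverse.to integral-↔ j))

    field
      holds-≡     : ∀ {x y x′ y′} → Corresponds x y x′ y′ →
                    ∀ i → IntegerProgram.Holds P i x y ≡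
                    IntegerProgram.Holds Q (Inverse.to constraint-↔ i) x′ y′
      objective-≈ : ∀ {x y x′ y′} → Corresponds x y x′ y′ →
                    IntegerProgram.objective Q x′ y′ ≈ IntegerProgram.objective P x y

    #variables-≡ : P.#variables ≡ Q.#variables
    #variables-≡ = cong₂ ℕ._+_ (size-cong binary-↔ P.binary-finite Q.binary-finite)
                               (size-cong integral-↔ P.integral-finite Q.integral-finite)

    #constraints-≡ : P.#constraints ≡ Q.#constraints
    #constraints-≡ = size-cong constraint-↔ P.constraint-finite Q.constraint-finite

    private
      module β = Inverse binary-↔
      module η = Inverse integral-↔
      module γ = Inverse constraint-↔

    push : P.Feasible → Q.Feasible
    push (P.feasible x y sat) = Q.feasible (x ∘ β.from) (y ∘ η.from) (λ i →
      -- Constraint `i` is rewritten as the image of `γ.from i`, where the corresponding constraint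
      -- of `P` is known to hold.
      subst (λ i → Q.Holds i (x ∘ β.from) (y ∘ η.from)) (γ.strictlyInverseˡ i)
        (subst id (holds-≡ (push-corresponds x y) (γ.from i)) (sat (γ.from i))))
      where
      push-corresponds : ∀ x y → Corresponds x y (x ∘ β.from) (y ∘ η.from)
      push-corresponds x y = (λ b → cong x (sym (β.strictlyInverseʳ b))) ,
                             (λ j → cong y (sym (η.strictlyInverseʳ j)))

    pull : Q.Feasible → P.Feasible
    pull (Q.feasible x y sat) = P.feasible (x ∘ β.to) (y ∘ η.to) (λ i →
      subst id (sym (holds-≡ ((λ _ → refl) , (λ _ → refl)) i)) (sat (γ.to i)))

    solutions : Bijection P.feasibleSolutions Q.feasibleSolutions
    solutions = record
      { to        = push
      ; cong      = λ (p , q) → (λ b → p (β.from b)) , (λ j → q (η.from j))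
      ; bijective =
          -- Injectivity: each index of `P` is recovered from its image, where the pushed solutions
          -- agree.
          (λ {s} {s′} (p , q) →
            (λ b → trans (cong (x s) (sym (β.strictlyInverseʳ b)))
                     (trans (p (β.to b)) (cong (x s′) (β.strictlyInverseʳ b)))) ,
            (λ j → trans (cong (y s) (sym (η.strictlyInverseʳ j)))
                     (trans (q (η.to j)) (cong (y s′) (η.strictlyInverseʳ j))))) ,
          (λ t → pull t , λ (p , q) →
            (λ b → trans (p (β.from b)) (cong (Q.Feasible.x t) (β.strictlyInverseˡ b))) ,
            (λ j → trans (q (η.from j)) (cong (Q.Feasible.y t) (η.strictlyInverseˡ j))))
      }
      where open P.Feasible using (x; y)

    value-≈ : ∀ s → Q.value-of (Bijection.to solutions s) ≈ P.value-of s
    value-≈ (P.feasible x y _) = objective-≈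
      ((λ b → cong x (sym (β.strictlyInverseʳ b))) , (λ j → cong y (sym (η.strictlyInverseʳ j))))

-- Sums over the lifts of a timed arc and over all auxiliary movement arcs.

module _ {ℓ₀ ℓ₁ ℓ₂} {R : OrderedCommutativeRing ℓ₀ ℓ₁ ℓ₂} (I : Instance R) (𝒜 : ValidPartition I) where
  open Instance I
  open ValidPartition 𝒜
  open Auxiliary I 𝒜

  module _ (k : K) where
    private
      movementCopy-↔ : TimeExpansion.MovementArc (Dⁿ I k) T ↔ TimeExpansion.MovementArc (Gⁿ k) T
      movementCopy-↔ = movementArc-↔ (Dᵏ≅Gᵏ I 𝒜 k) T
      open Inverse movementCopy-↔ using (to; from; strictlyInverseˡ)

      infix 4 _≟ᴬ_
      _≟ᴬ_ : DecidableEquality (A_T I)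
      _≟ᴬ_ = Finite._≟_ (A_T-finite I)

    module _ (x : TimedArc (Dⁿ I k) T → Fin 2) (x′ : TimedArc (Gⁿ k) T → Fin 2)
             (x≗x′ : ∀ m → x (inj₁ m) ≡ x′ (inj₁ (to m))) where

      -- If `e` belonged to the network of commodity `k`, its preimage under the isomorphism would
      -- be an arc of the original commodity network lying over `a` with lift `e`, which the
      -- hypothesis excludes. So `e` carries no variable.
      xᴳ-off-lift : ∀ a (e : ℰ_T a) → (∀ m → inclusion (Dᵏ k) m ≡ a → inclusion (Gᵏ k) (to m) ≢ value e) →
                    valueAt (Gᵏ k) x′ (value e) ≡ 0
      xᴳ-off-lift a (e , [ p ]) e≢ = valueAt-∉ (Gᵏ k) x′ e (λ m m≡e → e≢ (from m)
        (trans (cong base m≡e) (recompute (base e ≟ᴬ a) p))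
        (trans (cong (inclusion (Gᵏ k)) (strictlyInverseˡ m)) m≡e))

      xᴳ-lift : ∀ m → valueAt (Gᵏ k) x′ (inclusion (Gᵏ k) (to m)) ≡ valueAt (Dᵏ k) x (inclusion (Dᵏ k) m)
      xᴳ-lift m = trans (valueAt-inclusion (Gᵏ k) x′ (to m))
        (trans (cong toℕ (sym (x≗x′ m))) (sym (valueAt-inclusion (Dᵏ k) x m)))

      module _ (q : ℤ) where
        private
          term : ∀ a → ℰ_T a → ℤ
          term a e = q ℤ.* + valueAt (Gᵏ k) x′ (value e)

          vanishes : ∀ {n} → n ≡ 0 → q ℤ.* + n ≡ 0ℤ
          vanishes n≡0 = trans (cong (λ n → q ℤ.* + n) n≡0) (ℤ.*-zeroʳ q)

        ∑-ℰ_T-∉ : ∀ a (fin : Finite (ℰ_T a)) → (∀ m → inclusion (Dᵏ k) m ≢ a) →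
          Summation.∑ ℤ.+-0-commutativeMonoid fin (term a) ≡ q ℤ.* + valueAt (Dᵏ k) x a
        ∑-ℰ_T-∉ a fin a∉ = trans
          (∑ℤ.∑-zero fin {f = term a} (λ e →
            vanishes (xᴳ-off-lift a e (λ m m≡a → contradiction m≡a (a∉ m)))))
          (sym (vanishes (valueAt-∉ (Dᵏ k) x a a∉)))

        ∑-ℰ_T-∈ : ∀ m → let a = inclusion (Dᵏ k) m in (fin : Finite (ℰ_T a)) →
          Summation.∑ ℤ.+-0-commutativeMonoid fin (term a) ≡ q ℤ.* + valueAt (Dᵏ k) x a
        ∑-ℰ_T-∈ m fin = trans
          (∑ℤ.∑-single fin (term a) lift (λ e e≢lift →
            -- Any `m′` over `a` equals `m` by injectivity of the inclusion, so its lift is `lift`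
            -- and differs from `e`.
            vanishes (xᴳ-off-lift a e (λ m′ m′≡a eq → e≢lift (value-injective (trans (sym eq)
              (cong (λ m → inclusion (Gᵏ k) (to m)) (inclusion-injective (Dᵏ k) {T} {m′} {m} m′≡a))))))))
          (cong (λ n → q ℤ.* + n) (xᴳ-lift m))
          where
          a : A_T I
          a = inclusion (Dᵏ k) m
          lift : ℰ_T a
          lift = inclusion (Gᵏ k) (to m) , [ refl ]

        ∑-ℰ_T : ∀ a (fin : Finite (ℰ_T a)) →
          Summation.∑ ℤ.+-0-commutativeMonoid fin (term a) ≡ q ℤ.* + valueAt (Dᵏ k) x a
        ∑-ℰ_T a fin = by-cases (Finite.any? (TimeExpansion.movement-finite (Dⁿ I k) T)
                                 {P = λ m → inclusion (Dᵏ k) m ≡ a} (λ m → inclusion (Dᵏ k) m ≟ᴬ a))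
          where
          by-cases : Dec (∃ λ m → inclusion (Dᵏ k) m ≡ a) →
            Summation.∑ ℤ.+-0-commutativeMonoid fin (term a) ≡ q ℤ.* + valueAt (Dᵏ k) x a
          by-cases (yes (m , refl)) = ∑-ℰ_T-∈ m fin
          by-cases (no a∉)          = ∑-ℰ_T-∉ a fin (λ m m≡a → a∉ (m , m≡a))

      module _ {c ℓ} (M : CommutativeMonoid c ℓ) where
        private
          module M = CommutativeMonoid M
          module ∑M = SummationProperties M
        open Summation M using (∑)
        open ≈-Reasoning M.setoid

        -- Only arcs of the two commodity networks contribute. The isomorphism matches them and
        -- keeps the base arc, hence the coefficient in `g`.
        ∑-E_T : (A-fin : Finite (A_T I)) (E-fin : Finite E_T)
          (g : A_T I → ℕ → M.Carrier) → (∀ a → g a 0 M.≈ M.ε) →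
          ∑ E-fin (λ e → g (base e) (valueAt (Gᵏ k) x′ e)) M.≈
          ∑ A-fin (λ a → g a (valueAt (Dᵏ k) x a))
        -- Passing the enumerations to `go` as variables keeps them from being unfolded.
        ∑-E_T A-fin E-fin g g-zero = go (TimeExpansion.movement-finite (Dⁿ I k) T)
                                        (TimeExpansion.movement-finite (Gⁿ k) T)
          where
          go : Finite (TimeExpansion.MovementArc (Dⁿ I k) T) →
               Finite (TimeExpansion.MovementArc (Gⁿ k) T) →
               ∑ E-fin (λ e → g (base e) (valueAt (Gᵏ k) x′ e)) M.≈
               ∑ A-fin (λ a → g a (valueAt (Dᵏ k) x a))
          go Dᵏ-fin Gᵏ-fin = begin
            ∑ E-fin (λ e → g (base e) (valueAt (Gᵏ k) x′ e))
              ≈⟨ ∑-valueAt (Gᵏ k) x′ M Gᵏ-fin E-fin (λ e → g (base e)) (λ e → g-zero (base e)) ⟨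
            ∑ Gᵏ-fin (λ m → g (base (inclusion (Gᵏ k) m)) (toℕ (x′ (inj₁ m))))
              ≈⟨ ∑M.∑-reindex Dᵏ-fin Gᵏ-fin to (↔-injective movementCopy-↔)
                   (λ m → g (base (inclusion (Gᵏ k) m)) (toℕ (x′ (inj₁ m))))
                   (λ m m∉ → contradiction (strictlyInverseˡ m) (m∉ (from m))) ⟨
            ∑ Dᵏ-fin (λ m → g (inclusion (Dᵏ k) m) (toℕ (x′ (inj₁ (to m)))))
              ≈⟨ ∑M.∑-cong Dᵏ-fin (λ m →
                   M.reflexive (cong (λ i → g (inclusion (Dᵏ k) m) (toℕ i)) (x≗x′ m))) ⟨
            ∑ Dᵏ-fin (λ m → g (inclusion (Dᵏ k) m) (toℕ (x (inj₁ m))))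
              ≈⟨ ∑-valueAt (Dᵏ k) x M Dᵏ-fin A-fin g g-zero ⟩
            ∑ A-fin (λ a → g a (valueAt (Dᵏ k) x a)) ∎

-- The modules are opened unapplied, and the sums below are over arbitrary
-- enumerations, so that instantiating the lemmas gives the conditions of the two
-- programs syntactically: comparing unfolded enumerations of E_T or ℰ_T is
-- infeasible for the type checker.
open Instance using (K; K-finite; T; f; u; c; o; d; q; r; l; o∈Nᵏ; d∈Nᵏ)
open Auxiliary using (Gⁿ; o′; d⁰; E_T; E_T-finite; ℰ_T; ℰ_T-finite; base; Xᴳ; xᴳ)

-- Matching constraints and objectives of the two programs.

module _ {ℓ₀ ℓ₁ ℓ₂} {R : OrderedCommutativeRing ℓ₀ ℓ₁ ℓ₂} (I : Instance R) (𝒜 : ValidPartition I) where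
  private
    module R = OrderedCommutativeRing R
    P = SND-RR-D I
    Q = Auxiliary.SND-RR-G I 𝒜

  timedArcCopy-↔ : ∀ k → TimedArc (Dⁿ I k) (T I) ↔ TimedArc (Gⁿ I 𝒜 k) (T I)
  timedArcCopy-↔ k = _≅_.arc-↔ (timeExpanded-≅ (Dᵏ≅Gᵏ I 𝒜 k) (T I))

  timedNodeCopy-↔ : ∀ k → TimeExpansion.TimedNode (Dⁿ I k) (T I) ↔ TimeExpansion.TimedNode (Gⁿ I 𝒜 k) (T I)
  timedNodeCopy-↔ k = _≅_.node-↔ (timeExpanded-≅ (Dᵏ≅Gᵏ I 𝒜 k) (T I))

  constraintCopy-↔ : IntegerProgram.Constraint P ↔ IntegerProgram.Constraint Q
  constraintCopy-↔ = Σ-↔ (↔-id (K I)) (λ {k} → timedNodeCopy-↔ k) ⊎-↔ ↔-id (A_T I)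

  module _ {x : Xᴰ I → Fin 2} {x′ : Xᴳ I 𝒜 → Fin 2}
           (x≗x′ : ∀ k a → x (k , a) ≡ x′ (k , Inverse.to (timedArcCopy-↔ k) a))
           {y y′ : A_T I → ℕ} (y≗y′ : ∀ a → y a ≡ y′ a) where

    conservation-≡ : ∀ k n → IntegerProgram.Holds P (inj₁ (k , n)) x y ≡
      IntegerProgram.Holds Q (inj₁ (k , Inverse.to (timedNodeCopy-↔ k) n)) x′ y′
    conservation-≡ k n = conservation-≅ {Dⁿ I k} {Gⁿ I 𝒜 k} (Dᵏ≅Gᵏ I 𝒜 k) (T I)
      {λ a → x (k , a)} {λ e → x′ (k , e)} (x≗x′ k)
      (o I k , [ o∈Nᵏ I k ]) (d I k , [ d∈Nᵏ I k ]) {o′ I 𝒜 k} {d⁰ I 𝒜 k}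
      (copy-o I 𝒜 k) (copy-d I 𝒜 k) (r I k) (l I k) n (Inverse.to (timedNodeCopy-↔ k) n) refl

    load-≡ : (K-fin : Finite (K I)) → ∀ a (ℰ-fin : Finite (ℰ_T I 𝒜 a)) →
      Summation.∑ ℤ.+-0-commutativeMonoid K-fin (λ k → q I k ℤ.* + xᴰ I x k a) ≡
      Summation.∑ ℤ.+-0-commutativeMonoid K-fin (λ k →
        Summation.∑ ℤ.+-0-commutativeMonoid ℰ-fin (λ e → q I k ℤ.* + xᴳ I 𝒜 x′ k (value e)))
    load-≡ K-fin a ℰ-fin = ∑ℤ.∑-cong K-fin (λ k →
      sym (∑-ℰ_T I 𝒜 k (λ a → x (k , a)) (λ e → x′ (k , e)) (λ m → x≗x′ k (inj₁ m)) (q I k) a ℰ-fin))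

    capacity-≡ : ∀ a → IntegerProgram.Holds P (inj₂ a) x y ≡ IntegerProgram.Holds Q (inj₂ a) x′ y′
    capacity-≡ a = cong₂ (λ z n → z ℤ.≤ + (u I (arc I a) ℕ.* n))
      (load-≡ (K-finite I) a (ℰ_T-finite I 𝒜 a)) (y≗y′ a)

    holds-≡ : ∀ i → IntegerProgram.Holds P i x y ≡
      IntegerProgram.Holds Q (Inverse.to constraintCopy-↔ i) x′ y′
    holds-≡ (inj₁ (k , n)) = trans (conservation-≡ k n)
      (cong (λ i → IntegerProgram.Holds Q i x′ y′)
        {inj₁ (k , Inverse.to (timedNodeCopy-↔ k) n)} {Inverse.to constraintCopy-↔ (inj₁ (k , n))} refl)
    holds-≡ (inj₂ a) = trans (capacity-≡ a)
      (cong (λ i → IntegerProgram.Holds Q i x′ y′)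
        {inj₂ a} {Inverse.to constraintCopy-↔ (inj₂ a)} refl)

    module _ {a ℓ} (M : CommutativeMonoid a ℓ)
             (w : A_T I → ℕ → CommutativeMonoid.Carrier M)
             (z : K I → A_T I → ℕ → CommutativeMonoid.Carrier M)
             (z-zero : ∀ k a → CommutativeMonoid._≈_ M (z k a 0) (CommutativeMonoid.ε M)) where
      private
        module M = CommutativeMonoid M
        module ∑M = SummationProperties M

      -- The flow costs are summed over arcs first in one program and over commodities first in the
      -- other. For each commodity the sum over `E_T` collapses to one over `A_T`, and then the
      -- order of summation is exchanged.
      cost-≈ : (K-fin : Finite (K I)) (A-fin : Finite (A_T I)) (E-fin : Finite (E_T I 𝒜)) →
        (Summation.∑ M A-fin (λ a → w a (y′ a)) M.∙
         Summation.∑ M K-fin (λ k → Summation.∑ M E-fin (λ e → z k (base I 𝒜 e) (xᴳ I 𝒜 x′ k e)))) M.≈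
        (Summation.∑ M A-fin (λ a → w a (y a)) M.∙
         Summation.∑ M A-fin (λ a → Summation.∑ M K-fin (λ k → z k a (xᴰ I x k a))))
      cost-≈ K-fin A-fin E-fin = M.∙-cong
        (∑M.∑-cong A-fin (λ a → M.reflexive (cong (w a) (sym (y≗y′ a)))))
        (M.trans
          (∑M.∑-cong K-fin (λ k → ∑-E_T I 𝒜 k (λ a → x (k , a)) (λ e → x′ (k , e))
            (λ m → x≗x′ k (inj₁ m)) M A-fin E-fin (z k) (z-zero k)))
          (∑M.∑-swap K-fin A-fin (λ k a → z k a (xᴰ I x k a))))

    objective-≈ : IntegerProgram.objective Q x′ y′ R.≈ IntegerProgram.objective P x y
    objective-≈ =
      let ring = OrderedCommutativeRing.commutativeRing R
          +-monoid = SemiringWithoutAnnihilatingZero.+-commutativeMonoid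
            (Semiring.semiringWithoutAnnihilatingZero
              (CommutativeSemiring.semiring (CommutativeRing.commutativeSemiring ring)))
          _*_ = CommutativeRing._*_ ring
      in cost-≈ +-monoid
           (λ a n → f I (arc I a) * OrderedCommutativeRing.fromℕ R n)
           (λ k a n → (c I k (arc I a) * OrderedCommutativeRing.fromℤ R (q I k)) *
                      OrderedCommutativeRing.fromℕ R n)
           -- `fromℕ` of 0 is the zero of the ring, so an absent variable costs nothing.
           (λ k a → R.zeroʳ _)
           (K-finite I) (A_T-finite I) (E_T-finite I 𝒜)

  equivalence : ProgramEquivalence.Equivalence {_≈_ = R._≈_} P Q
  equivalence = record
    { binary-↔     = Σ-↔ (↔-id (K I)) (λ {k} → timedArcCopy-↔ k)
    ; integral-↔   = ↔-id (A_T I)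
    ; constraint-↔ = constraintCopy-↔
    ; holds-≡      = λ {x} {y} {x′} {y′} (p , q) → holds-≡ {x} {x′} (λ k a → p (k , a)) {y} {y′} q
    ; objective-≈  = λ {x} {y} {x′} {y′} (p , q) → objective-≈ {x} {x′} (λ k a → p (k , a)) {y} {y′} q
    }

theorem2 : ∀ {c ℓ₁ ℓ₂} (R : OrderedCommutativeRing c ℓ₁ ℓ₂) (I : Instance R) (𝒜 : ValidPartition I) →
    let open OrderedCommutativeRing R using (_≈_)
        P = SND-RR-D I
        Q = SND-RR-G I 𝒜
    in #variables P ≡ #variables Q
       × #constraints P ≡ #constraints Q
       × (Σ[ φ ∈ Bijection (feasibleSolutions P) (feasibleSolutions Q) ]
            (∀ s → value-of Q (Bijection.to φ s) ≈ value-of P s))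
theorem2 R I 𝒜 = #variables-≡ , #constraints-≡ , solutions , value-≈
  where open ProgramEquivalence.Equivalence (equivalence I 𝒜)
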